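{- Let $n\ge 4$ be an integer and let $K=\{123,132,231,321\}$. There are exactly two equivalence classes of $S_n$ under $K$-equivalence: one consisting of the permutations equivalent to the identity $123\cdots n$, and one consisting of the permutations equivalent to the identity with $1$ and $2$ swapped, i.e. $2134\cdots n$.
   Context: Permutations in $S_n$ are written as words $\pi_1\pi_2\cdots\pi_n$ in one-line notation. The order permutation of a word $u$ of $c$ distinct positive integers is the unique $\sigma\in S_c$ with $\sigma_i<\sigma_j$ iff $u_i<u_j$. A replacement partition $K$ of $S_c$ is a set partition of $S_c$; it is denoted by listing its parts with the one-element parts (and outer brackets) omitted, so here $K$ is the set partition of $S_3$ whose only part of size greater than one is $\{123,132,231,321\}$. The $K$-equivalence on $S_n$ is the equivalence relation generated by: $\phi\equiv\psi$ whenever $\phi=aub$ and $\psi=avb$ (concatenations) for some possibly empty words $a,b$ and words $u,v$ of length $c$ (so $u,v$ occupy the same $c$ consecutive positions) such that the order permutations of $u$ and $v$ lie in the same part of $K$. -}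

module Defs where

open import Data.Fin.Base using (Fin; toℕ)
open import Data.List.Base as List using (List; []; _∷_; _++_)
open import Data.List.Membership.Propositional using (_∈_)
open import Data.List.Relation.Binary.Permutation.Propositional
  using (_↭_; ↭-refl; ↭-trans; prep; swap)
open import Data.Nat.Base using (ℕ; suc; _<_)
open import Data.Product.Base using (_×_; _,_; ∃-syntax)
open import Data.Sum.Base using (_⊎_; inj₁; inj₂)
open import Data.Vec.Base as Vec using (Vec; []; _∷_; lookup; tabulate; toList)
open import Function.Base using (_∘_)
open import Function.Bundles using (_⇔_)
open import Level using (0ℓ)
open import Relation.Binary.Construct.Closure.Equivalence using (EqClosure)
open import Relation.Binary.Core using (Rel)
open import Relation.Binary.PropositionalEquality.Core using (_≡_; refl; sym; trans)
open import Relation.Binary.Structures using (IsEquivalence)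
open import Relation.Unary using (Pred; _≐_)

private
  variable
    c n : ℕ

oneTo : ∀ n → Vec ℕ n
oneTo n = tabulate (suc ∘ toℕ)

-- Permutations in one-line notation.  The proof field is irrelevant, so two
-- elements of S n are propositionally equal as soon as their words are.
record S (n : ℕ) : Set where
  constructor mkS
  field
    word    : Vec ℕ n
    .isPerm : toList word ↭ toList (oneTo n)

open S public

identity : ∀ n → S n
identity n = mkS (oneTo n) ↭-refl

exchange : Vec ℕ n → Vec ℕ n
exchange (x ∷ y ∷ w) = y ∷ x ∷ w
exchange w           = w

exchange-↭ : (w : Vec ℕ n) → toList (exchange w) ↭ toList w
exchange-↭ []          = ↭-refl
exchange-↭ (x ∷ [])    = ↭-refl
exchange-↭ (x ∷ y ∷ w) = swap y x ↭-refl

-- The permutation 2 1 3 4 ⋯ n (the identity when n < 2).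
swapped : ∀ n → S n
swapped n = mkS (exchange (oneTo n)) (exchange-↭ (oneTo n))

-- For a word u with distinct letters there is exactly one such σ.
IsOrderPermutation : S c → Vec ℕ c → Set
IsOrderPermutation σ u =
  ∀ i j → lookup (word σ) i < lookup (word σ) j ⇔ lookup u i < lookup u j

-- A set partition of S c, presented by its relation "lie in the same part".
record ReplacementPartition (c : ℕ) : Set₁ where
  field
    SamePart      : Rel (S c) 0ℓ
    isEquivalence : IsEquivalence SamePart

open ReplacementPartition public using (SamePart)

-- The partition with part P and every permutation outside P a part by itself.
onePart : List (S c) → ReplacementPartition c
onePart P = record
  { SamePart      = λ σ τ → σ ≡ τ ⊎ (σ ∈ P × τ ∈ P)
  ; isEquivalence = record
    { refl  = inj₁ refl
    ; sym   = λ { (inj₁ eq)      → inj₁ (sym eq)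
                ; (inj₂ (p , q)) → inj₂ (q , p) }
    ; trans = λ { (inj₁ refl)    r              → r
                ; r              (inj₁ refl)    → r
                ; (inj₂ (p , _)) (inj₂ (_ , q)) → inj₂ (p , q) }
    }
  }

data Replacement (K : ReplacementPartition c) (φ ψ : S n) : Set where
  replace : (a : List ℕ) (u v : Vec ℕ c) (b : List ℕ) (σ τ : S c) →
            toList (word φ) ≡ a ++ toList u ++ b →
            toList (word ψ) ≡ a ++ toList v ++ b →
            IsOrderPermutation σ u →
            IsOrderPermutation τ v →
            SamePart K σ τ →
            Replacement K φ ψ

KEquivalent : ReplacementPartition c → Rel (S n) 0ℓ
KEquivalent K = EqClosure (Replacement K)

class : ReplacementPartition c → S n → Pred (S n) 0ℓ
class K φ ψ = KEquivalent K ψ φ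

IsEquivalenceClass : ReplacementPartition c → Pred (Pred (S n) 0ℓ) 0ℓ
IsEquivalenceClass {n = n} K C = ∃[ φ ] C ≐ class {n = n} K φ

K₀ : ReplacementPartition 3
K₀ = onePart (p123 ∷ p132 ∷ p231 ∷ p321 ∷ [])
  where
  p123 p132 p231 p321 : S 3
  p123 = mkS (1 ∷ 2 ∷ 3 ∷ []) ↭-refl
  p132 = mkS (1 ∷ 3 ∷ 2 ∷ []) (prep 1 (swap 3 2 ↭-refl))
  p231 = mkS (2 ∷ 3 ∷ 1 ∷ []) (↭-trans (prep 2 (swap 3 1 ↭-refl)) (swap 2 1 ↭-refl))
  p321 = mkS (3 ∷ 2 ∷ 1 ∷ [])
    (↭-trans (swap 3 2 ↭-refl) (↭-trans (prep 2 (swap 3 1 ↭-refl)) (swap 2 1 ↭-refl)))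

{-# OPTIONS --safe #-}
module Submission where

-- Only a window whose middle letter is not its minimum may be rewritten, and it
-- may become any arrangement of the same letters whose middle letter is not the
-- minimum.
--
-- There are at least two classes.  A window containing the letter 1 has it in
-- the middle exactly when it is a valley (its middle letter is below both
-- neighbours), and a replacement does not change whether the window is a valley.
-- Hence 1 moves by an even number of places, and the parity of its position is
-- an invariant (`replacement-parity`).  It separates 123⋯n from 213⋯n.
--
-- There are at most two classes.  If m is the least letter of a word, then
-- x y m ~ m x y and m x y ~ m y x for all distinct x and y above m, so m can be
-- brought to the first or the second place (`surface`).
--   * If m comes first, the rest w can be sorted (`sortAfter`): bring the least
--     letter b of w to the first or second place of w; in the second case
--     m z b ~ m b z puts it first.  Recur with b in place of m.
--   * If m comes second, after x, let b be the second least letter.  If x = b,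
--     sort what follows m.  Otherwise bring b to the place after m; then four
--     letters x m b e suffice to exchange x for b (`exchangeHead`):
--     x m b e ~ x m e b ~ x e b m ~ b x e m ~ b e x m ~ b m e x.
--     The letter e is there because n is at least 4.
-- This is done on lists of numbers; `lift` carries the result over to S n.

open import Defs
open import Level using (0ℓ)
open import Data.Nat using (ℕ; _≥_)
open import Data.Product using (_×_)
open import Data.Sum using (_⊎_)
open import Relation.Nullary using (¬_)
open import Relation.Unary using (Pred; _≐_)

open import Data.Bool using (Bool; true; false; not; if_then_else_)
open import Data.Bool.Properties using (not-involutive)
open import Data.Empty using (⊥-elim)
open import Data.Fin using (Fin; zero; suc)
open import Data.List using (List; []; _∷_; _++_; length)
import Data.List as List
open import Data.List.Membership.DecPropositional Data.Nat._≟_ using (_∈?_)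
open import Data.List.Membership.Propositional using (_∈_; _∉_)
open import Data.List.Membership.Propositional.Properties using (∈-∃++)
open import Data.List.Relation.Binary.Permutation.Propositional
  using (_↭_; prep; swap; ↭-refl; ↭-sym; ↭-trans; ↭⇒↭ₛ)
open import Data.List.Relation.Binary.Permutation.Propositional.Properties
  using (↭-empty-inv; ¬x∷xs↭[]; ↭-length; ++⁺ˡ; shift; ++-comm; drop-∷;
         All-resp-↭; ∈-resp-↭)
import Data.List.Relation.Binary.Permutation.Setoid.Properties as SetoidPerm
open import Data.List.Relation.Unary.All as All using (All; []; _∷_)
import Data.List.Relation.Unary.All.Properties as All
open import Data.List.Relation.Unary.AllPairs as AllPairs using (AllPairs; []; _∷_)
import Data.List.Relation.Unary.AllPairs.Properties as AllPairs
open import Data.List.Relation.Unary.Any using (here; there)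
open import Data.List.Relation.Unary.Unique.Propositional using (Unique)
open import Data.Nat using (zero; suc; _<_; _≤_; s≤s; z≤n; _≟_; _<?_)
open import Data.Nat.Properties
  using (<⇒≢; <⇒≤; <-asym; <-irrefl; <-cmp; <-trans; ≤-refl; ≤∧≢⇒<; ≤-<-trans)
open import Data.Product using (∃; _,_; proj₁; proj₂)
open import Data.Sum as Sum using (inj₁; inj₂)
open import Data.Vec using (Vec; []; _∷_; toList; fromList; lookup; tabulate)
open import Data.Vec.Properties using (toList∘fromList; toList-injective; cast-is-id; length-toList)
open import Function using (_∘_; id)
open import Function.Bundles using (_⇔_; mk⇔; Equivalence)
import Function.Properties.Equivalence as ⇔
open import Relation.Binary.Construct.Closure.Equivalence as EqC using (EqClosure)
open import Relation.Binary.Construct.Closure.ReflexiveTransitive using (ε; _◅_; _◅◅_)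
open import Relation.Binary.Construct.Closure.Symmetric using (fwd; bwd)
open import Relation.Binary.Definitions using (DecidableEquality; tri<; tri≈; tri>)
open import Relation.Binary.PropositionalEquality
  using (_≡_; _≢_; refl; sym; trans; cong; subst; ≢-sym; setoid; isEquivalence)
open import Relation.Binary.Structures using (IsEquivalence)
open import Relation.Nullary using (Dec; yes; no; does)
open import Relation.Nullary.Decidable using (recompute; map′; _×-dec_; dec-false)

private
  variable
    n : ℕ
    k l w : List ℕ
    x y z m b c d e : ℕ

-- Permutations of lists

module _ {A : Set} (_≟ᴬ_ : DecidableEquality A) where

  open import Data.List.Membership.DecPropositional _≟ᴬ_ renaming (_∈?_ to _∈ᴬ?_)

  permutation? : (xs ys : List A) → Dec (xs ↭ ys)
  permutation? []       []       = yes ↭-refl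
  permutation? []       (_ ∷ _)  = no (¬x∷xs↭[] ∘ ↭-sym)
  permutation? (x ∷ xs) ys with x ∈ᴬ? ys
  ... | no x∉ys = no λ p → x∉ys (∈-resp-↭ p (here refl))
  ... | yes x∈ys with ps , qs , refl ← ∈-∃++ x∈ys =
    map′ (λ p → ↭-trans (prep x p) (↭-sym (shift x ps qs)))
         (λ p → drop-∷ (↭-trans p (shift x ps qs)))
         (permutation? xs (ps ++ qs))

++-cancelˡ-↭ : ∀ {A : Set} (xs : List A) {ys zs} → xs ++ ys ↭ xs ++ zs → ys ↭ zs
++-cancelˡ-↭ []       p = p
++-cancelˡ-↭ (x ∷ xs) p = ++-cancelˡ-↭ xs (drop-∷ p)

++-cancelʳ-↭ : ∀ {A : Set} {xs ys : List A} zs → xs ++ zs ↭ ys ++ zs → xs ↭ ys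
++-cancelʳ-↭ zs p =
  ++-cancelˡ-↭ zs (↭-trans (++-comm zs _) (↭-trans p (++-comm _ zs)))

Unique-resp-↭ : k ↭ l → Unique k → Unique l
Unique-resp-↭ = SetoidPerm.Unique-resp-↭ (setoid ℕ) ∘ ↭⇒↭ₛ

increasing⇒unique : AllPairs _<_ l → Unique l
increasing⇒unique = AllPairs.map <⇒≢

-- The permutation property is an irrelevant field; being decidable, it can be
-- recovered for use in computations.
word-↭ : (φ : S n) → toList (word φ) ↭ toList (oneTo n)
word-↭ (mkS _ p) = recompute (permutation? _≟_ _ _) p

toList-tabulate : ∀ {A : Set} n (f : Fin n → A) →
  toList (tabulate f) ≡ List.tabulate f
toList-tabulate zero    f = refl
toList-tabulate (suc n) f = cong (f zero ∷_) (toList-tabulate n (f ∘ suc))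

oneTo-increasing : ∀ n → AllPairs _<_ (toList (oneTo n))
oneTo-increasing n = subst (AllPairs _<_) (sym (toList-tabulate n _))
  (AllPairs.tabulate⁺-< s≤s)

oneTo-positive : ∀ n → All (1 ≤_) (toList (oneTo n))
oneTo-positive n = subst (All (1 ≤_)) (sym (toList-tabulate n _))
  (All.tabulate⁺ λ _ → s≤s z≤n)

-- Rewriting words

-- Two moves on words which, with their inverses, connect all arrangements of a
-- window that do not have its least letter x in the middle.
data Move : List ℕ → List ℕ → Set where
  flip   : ∀ a b → x < y → x < z → y ≢ z →
           Move (a ++ x ∷ y ∷ z ∷ b) (a ++ x ∷ z ∷ y ∷ b)
  rotate : ∀ a b → x < y → x < z → y ≢ z →
           Move (a ++ x ∷ y ∷ z ∷ b) (a ++ y ∷ z ∷ x ∷ b)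

infix 4 _~_
_~_ : List ℕ → List ℕ → Set
_~_ = EqClosure Move

~-sym : k ~ l → l ~ k
~-sym = EqC.symmetric Move

~-cons : ∀ x → k ~ l → x ∷ k ~ x ∷ l
~-cons x = EqC.gmap (x ∷_) λ where
  (flip a b p q r)   → flip (x ∷ a) b p q r
  (rotate a b p q r) → rotate (x ∷ a) b p q r

~-flip : x < y → x < z → y ≢ z → x ∷ y ∷ z ∷ w ~ x ∷ z ∷ y ∷ w
~-flip p q r = EqC.return (flip [] _ p q r)

~-rotate : x < y → x < z → y ≢ z → x ∷ y ∷ z ∷ w ~ y ∷ z ∷ x ∷ w
~-rotate p q r = EqC.return (rotate [] _ p q r)

move-↭ : Move k l → k ↭ l
move-↭ (flip {x} {y} {z} a b _ _ _)   = ++⁺ˡ a (prep x (swap y z ↭-refl))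
move-↭ (rotate {x} {y} {z} a b _ _ _) =
  ++⁺ˡ a (↭-trans (swap x y ↭-refl) (prep y (swap x z ↭-refl)))

~-↭ : k ~ l → k ↭ l
~-↭ = EqC.fold (record { refl = ↭-refl ; sym = ↭-sym ; trans = ↭-trans }) move-↭

-- Normal forms

-- The letter b can be moved to the first or second place of the word.
data Surfaces (b : ℕ) (w : List ℕ) : Set where
  first  : ∀ v → w ~ b ∷ v → Surfaces b w
  second : ∀ z v → w ~ z ∷ b ∷ v → Surfaces b w

surface : b ∈ w → All (b ≤_) w → Unique w → Surfaces b w
surface (here refl) _ _ = first _ ε
surface {w = x ∷ w} (there b∈w) (b≤x ∷ b≤w) uniq@(_ ∷ uniq-w)
  with surface b∈w b≤w uniq-w
... | first v p    = second x v (~-cons x p)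
... | second z v p
  with (x≢z ∷ x≢b ∷ _) ∷ (z≢b ∷ _) ∷ _ ← Unique-resp-↭ (~-↭ (~-cons x p)) uniq
     | b≤z ∷ _ ← All-resp-↭ (~-↭ p) b≤w
  = first (x ∷ z ∷ v)
      (~-cons x p ◅◅ ~-sym (~-rotate (≤∧≢⇒< b≤x (≢-sym x≢b)) (≤∧≢⇒< b≤z (≢-sym z≢b)) x≢z))

-- The least letter of an increasing word surfaces in every rearrangement.
surface-least : AllPairs _<_ (b ∷ l) → w ↭ b ∷ l → Surfaces b w
surface-least inc@(b<l ∷ _) p =
  surface (∈-resp-↭ (↭-sym p) (here refl))
          (All-resp-↭ (↭-sym p) (≤-refl ∷ All.map <⇒≤ b<l))
          (Unique-resp-↭ (↭-sym p) (increasing⇒unique inc))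

-- After a lesser letter m, any word can be sorted.
sortAfter : AllPairs _<_ (m ∷ l) → w ↭ l → m ∷ w ~ m ∷ l
sortAfter {l = []}    _ p with refl ← ↭-empty-inv p = ε
sortAfter {m} {b ∷ l} ((m<b ∷ m<l) ∷ inc@(b<l ∷ _)) p with surface-least inc p
... | first v q = ~-cons m q
  ◅◅ ~-cons m (sortAfter inc (drop-∷ (↭-trans (↭-sym (~-↭ q)) p)))
... | second z v q = ~-cons m q ◅◅ ~-flip m<z m<b (≢-sym (<⇒≢ b<z))
  ◅◅ ~-cons m (sortAfter inc zv↭l)
  where
  zv↭l : z ∷ v ↭ l
  zv↭l = drop-∷ (↭-trans (swap b z ↭-refl) (↭-trans (↭-sym (~-↭ q)) p))
  b<z : b < z
  b<z = All.head (All-resp-↭ (↭-sym zv↭l) b<l)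
  m<z : m < z
  m<z = All.head (All-resp-↭ (↭-sym zv↭l) m<l)

exchangeHead : m < b → m < e → m < x → b < e → b < x → x ≢ e →
  x ∷ m ∷ b ∷ e ∷ w ~ b ∷ m ∷ e ∷ x ∷ w
exchangeHead {m} {b} {e} {x} m<b m<e m<x b<e b<x x≢e =
     ~-cons x (~-flip m<b m<e (<⇒≢ b<e))
  ◅◅ ~-cons x (~-rotate m<e m<b (≢-sym (<⇒≢ b<e)))
  ◅◅ ~-sym (~-rotate b<x b<e x≢e)
  ◅◅ ~-flip b<x b<e x≢e
  ◅◅ ~-cons b (~-sym (~-rotate m<e m<x (≢-sym x≢e)))

-- The case of `sortAround` in which b already follows m.
sortAround₃ : AllPairs _<_ (m ∷ b ∷ c ∷ d ∷ l) → ∀ v → x ∷ v ↭ c ∷ d ∷ l →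
  x ∷ m ∷ b ∷ v ~ b ∷ m ∷ c ∷ d ∷ l
sortAround₃ _ [] p with () ← ↭-length p
sortAround₃ {m} {b} {c} {d} {l} {x} ((m<b ∷ m<l) ∷ b<l ∷ inc) (e ∷ v) p
  with m<x ∷ m<e ∷ _ ← All-resp-↭ (↭-sym p) m<l
     | b<x ∷ b<e ∷ _ ← All-resp-↭ (↭-sym p) b<l
     | (x≢e ∷ _) ∷ _ ← Unique-resp-↭ (↭-sym p) (increasing⇒unique inc)
  = exchangeHead m<b m<e m<x b<e b<x x≢e
    ◅◅ ~-cons b (sortAfter (m<l ∷ inc) (↭-trans (swap e x ↭-refl) p))

-- A word with its least letter m in the second place is equivalent to the
-- sorted word with its first two letters exchanged.
sortAround : AllPairs _<_ (m ∷ b ∷ c ∷ d ∷ l) → x ∷ w ↭ b ∷ c ∷ d ∷ l →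
  x ∷ m ∷ w ~ b ∷ m ∷ c ∷ d ∷ l
sortAround {m} {b} {x = x} {w} inc@((m<b ∷ m<l) ∷ incᵇ@(b<l ∷ incˡ)) p with x ≟ b
... | yes refl = ~-cons b (sortAfter (m<l ∷ incˡ) (drop-∷ p))
... | no x≢b with surface b∈w b≤w uniq-w
  where
  b∈w : b ∈ w
  b∈w with ∈-resp-↭ (↭-sym p) (here refl)
  ... | here b≡x  = ⊥-elim (x≢b (sym b≡x))
  ... | there b∈w = b∈w
  b≤w : All (b ≤_) w
  b≤w = All.tail (All-resp-↭ (↭-sym p) (≤-refl ∷ All.map <⇒≤ b<l))
  uniq-w : Unique w
  uniq-w = AllPairs.tail (Unique-resp-↭ (↭-sym p) (increasing⇒unique incᵇ))
... | first v q = ~-cons x (~-cons m q) ◅◅ sortAround₃ inc v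
  (drop-∷ (↭-trans (swap b x ↭-refl) (↭-trans (prep x (↭-sym (~-↭ q))) p)))
... | second z v q =
     ~-cons x (~-cons m q)
  ◅◅ ~-cons x (~-flip m<z m<b (≢-sym (<⇒≢ b<z)))
  ◅◅ sortAround₃ inc (z ∷ v) xzv↭l
  where
  xzv↭l : x ∷ z ∷ v ↭ _
  xzv↭l = drop-∷ (↭-trans (swap b x ↭-refl)
    (↭-trans (prep x (↭-trans (swap b z ↭-refl) (↭-sym (~-↭ q)))) p))
  b<z : b < z
  b<z = All.head (All.tail (All-resp-↭ (↭-sym xzv↭l) b<l))
  m<z : m < z
  m<z = <-trans m<b b<z

normalForm : AllPairs _<_ (m ∷ b ∷ c ∷ d ∷ l) → w ↭ m ∷ b ∷ c ∷ d ∷ l →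
  w ~ m ∷ b ∷ c ∷ d ∷ l ⊎ w ~ b ∷ m ∷ c ∷ d ∷ l
normalForm {m} inc p with surface-least inc p
... | first v q    = inj₁ (q ◅◅ sortAfter inc (drop-∷ (↭-trans (↭-sym (~-↭ q)) p)))
... | second x v q = inj₂ (q ◅◅ sortAround inc
  (drop-∷ (↭-trans (swap m x ↭-refl) (↭-trans (↭-sym (~-↭ q)) p))))

-- From moves to replacements

-- The letters p , q are in the same strict order as x , y.
SameOrder : (p q x y : ℕ) → Set
SameOrder p q x y = (p < q × x < y) ⊎ (q < p × y < x)

sameOrder-⇔ : ∀ {p q} → SameOrder p q x y → p < q ⇔ x < y
sameOrder-⇔ (inj₁ (p<q , x<y)) = mk⇔ (λ _ → x<y) (λ _ → p<q)
sameOrder-⇔ (inj₂ (q<p , y<x)) = mk⇔ (⊥-elim ∘ <-asym q<p) (⊥-elim ∘ <-asym y<x)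

sameOrder-swap : ∀ {p q} → SameOrder p q x y → SameOrder q p y x
sameOrder-swap (inj₁ p) = inj₂ p
sameOrder-swap (inj₂ p) = inj₁ p

<-diagonal : x < x ⇔ y < y
<-diagonal = mk⇔ (⊥-elim ∘ <-irrefl refl) (⊥-elim ∘ <-irrefl refl)

-- The order permutation of the word x y z is σ, stated pair by pair.
Ordered : S 3 → (x y z : ℕ) → Set
Ordered σ x y z = SameOrder p q x y × SameOrder p r x z × SameOrder q r y z
  where
  p q r : ℕ
  p = lookup (word σ) zero
  q = lookup (word σ) (suc zero)
  r = lookup (word σ) (suc (suc zero))

ordered⇒isOrderPermutation : ∀ σ → Ordered σ x y z →
  IsOrderPermutation σ (x ∷ y ∷ z ∷ [])
ordered⇒isOrderPermutation σ (xy , xz , yz) = λ where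
  zero             zero             → <-diagonal
  zero             (suc zero)       → sameOrder-⇔ xy
  zero             (suc (suc zero)) → sameOrder-⇔ xz
  (suc zero)       zero             → sameOrder-⇔ (sameOrder-swap xy)
  (suc zero)       (suc zero)       → <-diagonal
  (suc zero)       (suc (suc zero)) → sameOrder-⇔ yz
  (suc (suc zero)) zero             → sameOrder-⇔ (sameOrder-swap xz)
  (suc (suc zero)) (suc zero)       → sameOrder-⇔ (sameOrder-swap yz)
  (suc (suc zero)) (suc (suc zero)) → <-diagonal

1<2 : 1 < 2
1<2 = s≤s (s≤s z≤n)

1<3 : 1 < 3
1<3 = s≤s (s≤s z≤n)

2<3 : 2 < 3
2<3 = s≤s (s≤s (s≤s z≤n))

replaceWindow : ∀ {σ τ x y z x′ y′ z′} (φ ψ : S n) a b →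
  toList (word φ) ≡ a ++ x ∷ y ∷ z ∷ b →
  toList (word ψ) ≡ a ++ x′ ∷ y′ ∷ z′ ∷ b →
  SamePart K₀ σ τ → Ordered σ x y z → Ordered τ x′ y′ z′ → Replacement K₀ φ ψ
replaceWindow {σ = σ} {τ} φ ψ a b φ≡ ψ≡ same σ-u τ-v = replace a _ _ b σ τ φ≡ ψ≡
  (ordered⇒isOrderPermutation σ σ-u) (ordered⇒isOrderPermutation τ τ-v) same

move⇒replacement : (φ ψ : S n) →
  Move k l → toList (word φ) ≡ k → toList (word ψ) ≡ l → Replacement K₀ φ ψ
move⇒replacement φ ψ (flip {x} {y} {z} a b x<y x<z y≢z) φ≡ ψ≡ with <-cmp y z
... | tri≈ _ y≡z _ = ⊥-elim (y≢z y≡z)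
-- 123 becomes 132.
... | tri< y<z _ _ = replaceWindow φ ψ a b φ≡ ψ≡ (inj₂ (here refl , there (here refl)))
  (inj₁ (1<2 , x<y) , inj₁ (1<3 , x<z) , inj₁ (2<3 , y<z))
  (inj₁ (1<3 , x<z) , inj₁ (1<2 , x<y) , inj₂ (2<3 , y<z))
-- 132 becomes 123.
... | tri> _ _ z<y = replaceWindow φ ψ a b φ≡ ψ≡ (inj₂ (there (here refl) , here refl))
  (inj₁ (1<3 , x<y) , inj₁ (1<2 , x<z) , inj₂ (2<3 , z<y))
  (inj₁ (1<2 , x<z) , inj₁ (1<3 , x<y) , inj₁ (2<3 , z<y))
move⇒replacement φ ψ (rotate {x} {y} {z} a b x<y x<z y≢z) φ≡ ψ≡ with <-cmp y z
... | tri≈ _ y≡z _ = ⊥-elim (y≢z y≡z)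
-- 123 becomes 231.
... | tri< y<z _ _ = replaceWindow φ ψ a b φ≡ ψ≡
  (inj₂ (here refl , there (there (here refl))))
  (inj₁ (1<2 , x<y) , inj₁ (1<3 , x<z) , inj₁ (2<3 , y<z))
  (inj₁ (2<3 , y<z) , inj₂ (1<2 , x<y) , inj₂ (1<3 , x<z))
-- 132 becomes 321.
... | tri> _ _ z<y = replaceWindow φ ψ a b φ≡ ψ≡
  (inj₂ (there (here refl) , there (there (there (here refl)))))
  (inj₁ (1<3 , x<y) , inj₁ (1<2 , x<z) , inj₂ (2<3 , z<y))
  (inj₂ (2<3 , z<y) , inj₂ (1<3 , x<y) , inj₂ (1<2 , x<z))

fromList-↭ : (φ : S n) → toList (word φ) ↭ l → ∃ λ (ψ : S n) → toList (word ψ) ≡ l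
fromList-↭ {n} {l} φ p = mkS (proj₁ lv) (subst (_↭ _) (sym (proj₂ lv)) l↭) , proj₂ lv
  where
  ofLength : ∀ {n} (l : List ℕ) → length l ≡ n → ∃ λ (v : Vec ℕ n) → toList v ≡ l
  ofLength l refl = fromList l , toList∘fromList l
  l↭ : l ↭ toList (oneTo n)
  l↭ = ↭-trans (↭-sym p) (word-↭ φ)
  lv : ∃ λ (v : Vec ℕ n) → toList v ≡ l
  lv = ofLength l (trans (↭-length l↭) (length-toList (oneTo n)))

word-injective : (φ ψ : S n) → toList (word φ) ≡ toList (word ψ) → φ ≡ ψ
word-injective (mkS u _) (mkS v _) eq 
  with refl ← trans (sym (cast-is-id refl u)) (toList-injective refl u v eq) = refl

-- Moves rearrange the letters, so every word on a path that starts at a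
-- permutation is itself the word of a permutation.
lift : (φ ψ : S n) → k ~ l → toList (word φ) ≡ k → toList (word ψ) ≡ l →
  KEquivalent K₀ φ ψ
lift φ ψ ε refl ψ≡ with refl ← word-injective φ ψ (sym ψ≡) = ε
lift φ ψ (fwd s ◅ p) refl ψ≡ with χ , χ≡ ← fromList-↭ φ (move-↭ s) =
  fwd (move⇒replacement φ χ s refl χ≡) ◅ lift χ ψ p χ≡ ψ≡
lift φ ψ (bwd s ◅ p) refl ψ≡ with χ , χ≡ ← fromList-↭ φ (↭-sym (move-↭ s)) =
  bwd (move⇒replacement χ φ s χ≡ refl) ◅ lift χ ψ p χ≡ ψ≡

-- The parity invariant

-- The parity of the number of letters before the first 1, with true for odd.
-- (In a word without 1, the parity of its length.)
oddBefore1 : List ℕ → Bool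
oddBefore1 []      = false
oddBefore1 (x ∷ l) = if does (x ≟ 1) then false else not (oddBefore1 l)

oddBefore1-≢ : ∀ l → x ≢ 1 → oddBefore1 (x ∷ l) ≡ not (oddBefore1 l)
oddBefore1-≢ {x} l x≢1 rewrite dec-false (x ≟ 1) x≢1 = refl

-- The middle letter of the window is below both its neighbours.
Valley : Vec ℕ 3 → Set
Valley (x ∷ y ∷ z ∷ []) = y < x × y < z

valley? : ∀ u → Dec (Valley u)
valley? (x ∷ y ∷ z ∷ []) = (y <? x) ×-dec (y <? z)

orderPermutation-valley : (σ : S 3) (u : Vec ℕ 3) →
  IsOrderPermutation σ u → Valley (word σ) ⇔ Valley u
orderPermutation-valley (mkS (p ∷ q ∷ r ∷ []) _) (x ∷ y ∷ z ∷ []) ord =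
  mk⇔ (λ (s , t) → to left s , to right t) (λ (s , t) → from left s , from right t)
  where
  open Equivalence
  left  = ord (suc zero) zero
  right = ord (suc zero) (suc (suc zero))

-- Inside the part with four elements there are no valleys.
samePart-valley : (σ τ : S 3) → SamePart K₀ σ τ → Valley (word σ) → Valley (word τ)
samePart-valley σ τ (inj₁ refl)  = id
samePart-valley σ τ (inj₂ (p , _)) v = ⊥-elim (part-valley p v)
  where
  part-valley : ∀ {σ} → σ ∈ _ → ¬ Valley (word σ)
  part-valley (here refl)                         (s≤s () , _)
  part-valley (there (here refl))                 (s≤s () , _)
  part-valley (there (there (here refl)))         (s≤s (s≤s ()) , _)
  part-valley (there (there (there (here refl)))) (_ , s≤s ())

module _ {x y z : ℕ} where

  private
    u : Vec ℕ 3
    u = x ∷ y ∷ z ∷ []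

  valley-parity : ∀ l → All (1 ≤_) (toList u ++ l) → Valley u → 1 ∈ toList u →
    oddBefore1 (toList u ++ l) ≡ true
  valley-parity l (1≤x ∷ 1≤y ∷ 1≤z ∷ _) (y<x , y<z) = λ where
    (here refl)                 → ⊥-elim (<-irrefl refl (≤-<-trans 1≤y y<x))
    (there (here refl))         → oddBefore1-≢ (1 ∷ z ∷ l) (≢-sym (<⇒≢ y<x))
    (there (there (here refl))) → ⊥-elim (<-irrefl refl (≤-<-trans 1≤y y<z))

  nonvalley-parity : ∀ l → All (1 ≤_) (toList u ++ l) → Unique (toList u ++ l) →
    ¬ Valley u → 1 ∈ toList u → oddBefore1 (toList u ++ l) ≡ false
  nonvalley-parity l (1≤x ∷ 1≤y ∷ 1≤z ∷ _) ((x≢y ∷ x≢z ∷ _) ∷ (y≢z ∷ _) ∷ _) ¬v = λ where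
    (here refl)                 → refl
    (there (here refl))         →
      ⊥-elim (¬v (≤∧≢⇒< 1≤x (≢-sym x≢y) , ≤∧≢⇒< 1≤z y≢z))
    (there (there (here refl))) →
      trans (oddBefore1-≢ (y ∷ 1 ∷ l) x≢z) (cong not (oddBefore1-≢ (1 ∷ l) y≢z))

  no1-parity : ∀ l → 1 ∉ toList u → oddBefore1 (toList u ++ l) ≡ not (oddBefore1 l)
  no1-parity l 1∉u =
    trans (oddBefore1-≢ (y ∷ z ∷ l) λ x≡1 → 1∉u (here (sym x≡1)))
      (trans (cong not (trans (oddBefore1-≢ (z ∷ l) λ y≡1 → 1∉u (there (here (sym y≡1))))
        (cong not (oddBefore1-≢ l λ z≡1 → 1∉u (there (there (here (sym z≡1))))))))
      (not-involutive _))

window-parity : (u v : Vec ℕ 3) (l : List ℕ) → Valley u ⇔ Valley v →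
  All (1 ≤_) (toList u ++ l) → Unique (toList u ++ l) → toList u ++ l ↭ toList v ++ l →
  oddBefore1 (toList u ++ l) ≡ oddBefore1 (toList v ++ l)
window-parity u@(_ ∷ _ ∷ _ ∷ []) v@(_ ∷ _ ∷ _ ∷ []) l u⇔v pos uniq p
  with 1 ∈? toList u | valley? u
... | no 1∉u  | _ = trans (no1-parity l 1∉u)
  (sym (no1-parity l (1∉u ∘ ∈-resp-↭ (↭-sym (++-cancelʳ-↭ l p)))))
... | yes 1∈u | yes vu = trans (valley-parity l pos vu 1∈u)
  (sym (valley-parity l (All-resp-↭ p pos) (Equivalence.to u⇔v vu)
    (∈-resp-↭ (++-cancelʳ-↭ l p) 1∈u)))
... | yes 1∈u | no ¬vu = trans (nonvalley-parity l pos uniq ¬vu 1∈u)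
  (sym (nonvalley-parity l (All-resp-↭ p pos) (Unique-resp-↭ p uniq)
    (¬vu ∘ Equivalence.from u⇔v) (∈-resp-↭ (++-cancelʳ-↭ l p) 1∈u)))

-- The letters before the window only need to be the same on both sides:
-- `oddBefore1` of x ∷ l depends on l through `oddBefore1 l` alone.
context-parity : ∀ a (u v : Vec ℕ 3) (l : List ℕ) → Valley u ⇔ Valley v →
  All (1 ≤_) (a ++ toList u ++ l) → Unique (a ++ toList u ++ l) →
  a ++ toList u ++ l ↭ a ++ toList v ++ l →
  oddBefore1 (a ++ toList u ++ l) ≡ oddBefore1 (a ++ toList v ++ l)
context-parity []      u v l u⇔v pos       uniq       p = window-parity u v l u⇔v pos uniq p
context-parity (x ∷ a) u v l u⇔v (_ ∷ pos) (_ ∷ uniq) p =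
  cong (λ o → if does (x ≟ 1) then false else not o)
    (context-parity a u v l u⇔v pos uniq (drop-∷ p))

replacement-parity : {φ ψ : S n} → Replacement K₀ φ ψ →
  oddBefore1 (toList (word φ)) ≡ oddBefore1 (toList (word ψ))
replacement-parity {n} {φ} {ψ} (replace a u v l σ τ φ≡ ψ≡ σ-u τ-v same) =
  trans (cong oddBefore1 φ≡)
    (trans (context-parity a u v l u⇔v pos uniq p) (cong oddBefore1 (sym ψ≡)))
  where
  module ≈ᴷ = IsEquivalence (ReplacementPartition.isEquivalence K₀)
  u⇔v : Valley u ⇔ Valley v
  u⇔v = ⇔.trans (⇔.sym (orderPermutation-valley σ u σ-u))
    (⇔.trans (mk⇔ (samePart-valley σ τ same) (samePart-valley τ σ (≈ᴷ.sym same)))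
      (orderPermutation-valley τ v τ-v))
  φ↭ : a ++ toList u ++ l ↭ toList (oneTo n)
  φ↭ = subst (_↭ _) φ≡ (word-↭ φ)
  p : a ++ toList u ++ l ↭ a ++ toList v ++ l
  p = ↭-trans φ↭ (↭-sym (subst (_↭ _) ψ≡ (word-↭ ψ)))
  pos : All (1 ≤_) (a ++ toList u ++ l)
  pos = All-resp-↭ (↭-sym φ↭) (oneTo-positive n)
  uniq : Unique (a ++ toList u ++ l)
  uniq = Unique-resp-↭ (↭-sym φ↭) (increasing⇒unique (oneTo-increasing n))

equivalent-parity : {φ ψ : S n} → KEquivalent K₀ φ ψ →
  oddBefore1 (toList (word φ)) ≡ oddBefore1 (toList (word ψ))
equivalent-parity = EqC.gfold isEquivalence (oddBefore1 ∘ toList ∘ word) replacement-parity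

-- The two classes

identity≁swapped : n ≥ 4 → ¬ KEquivalent K₀ (identity n) (swapped n)
identity≁swapped (s≤s (s≤s _)) p with () ← equivalent-parity p

classify : n ≥ 4 → (φ : S n) →
  KEquivalent K₀ φ (identity n) ⊎ KEquivalent K₀ φ (swapped n)
classify {n} (s≤s (s≤s (s≤s (s≤s _)))) φ with normalForm (oneTo-increasing n) (word-↭ φ)
... | inj₁ p = inj₁ (lift φ _ p refl refl)
... | inj₂ p = inj₂ (lift φ _ p refl refl)

class-cong : {φ ψ : S n} {C : Pred (S n) 0ℓ} → KEquivalent K₀ φ ψ →
  C ≐ class K₀ φ → C ≐ class K₀ ψ
class-cong p (C⊆ , ⊆C) =
  (λ q → C⊆ q ◅◅ p) , (λ q → ⊆C (q ◅◅ EqC.symmetric (Replacement K₀) p))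

proposition2p38 : (n : ℕ) → n ≥ 4 →
    IsEquivalenceClass K₀ (class K₀ (identity n)) ×
    IsEquivalenceClass K₀ (class K₀ (swapped n)) ×
    ¬ (class K₀ (identity n) ≐ class K₀ (swapped n)) ×
    ((C : Pred (S n) 0ℓ) → IsEquivalenceClass K₀ C →
    C ≐ class K₀ (identity n) ⊎ C ≐ class K₀ (swapped n))
proposition2p38 n n≥4 =
    (identity n , id , id)
  , (swapped n , id , id)
  , (λ (id⊆swapped , _) → identity≁swapped n≥4 (id⊆swapped ε))
  , λ where
      C (φ , C≐φ) → Sum.map (λ p → class-cong p C≐φ) (λ p → class-cong p C≐φ)
                      (classify n≥4 φ)
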